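{- There is a satisfiable $X_a$-free $\mathrm{Hyper^2LTL}$ sentence (over some nonempty finite set $\mathrm{AP}$ of atomic propositions) all of whose models have cardinality $\mathfrak{c}$. This holds both under standard semantics and under closed-world semantics.
   Context: $\mathfrak{c}$ is the cardinality of the continuum. Syntax. Let $\mathrm{AP}$ be a nonempty finite set of atomic propositions. A trace over $\mathrm{AP}$ is an element $t=t(0)t(1)t(2)\cdots$ of $(2^{\mathrm{AP}})^\omega$. Let $\mathcal V_1$ be a set of trace variables $\pi$ and $\mathcal V_2$ a disjoint set of second-order variables $X$ (ranging over sets of traces), with two distinguished variables $X_a,X_d\in\mathcal V_2$. $\mathrm{Hyper^2LTL}$ formulas are given by $\varphi ::= \exists X.\,\varphi \mid \forall X.\,\varphi \mid \exists \pi\in X.\,\varphi \mid \forall\pi\in X.\,\varphi \mid \psi$ and $\psi ::= p_\pi \mid \neg\psi \mid \psi\vee\psi \mid \mathbf{X}\psi \mid \psi\,\mathbf{U}\,\psi$, with $p\in\mathrm{AP}$, $\pi\in\mathcal V_1$, $X\in\mathcal V_2$. A sentence is a formula in which at most $X_a,X_d$ are free. A sentence is $X_a$-free if $X_a$ does not occur in it. Standard semantics. A variable assignment $\Pi$ is a partial map sending trace variables to traces and second-order variables to sets of traces; $\Pi[\cdot\mapsto\cdot]$ denotes updating; $\Pi[j,\infty)$ maps each trace variable $\pi$ in the domain to the suffix of $\Pi(\pi)$ starting at position $j$. Define $\Pi\models p_\pi$ iff $p\in\Pi(\pi)(0)$; Boolean connectives as usual; $\Pi\models\mathbf{X}\psi$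 iff $\Pi[1,\infty)\models\psi$; $\Pi\models\psi_1\mathbf{U}\psi_2$ iff there is $j\ge0$ with $\Pi[j,\infty)\models\psi_2$ and $\Pi[j',\infty)\models\psi_1$ for all $0\le j'<j$; $\Pi\models\exists\pi\in X.\varphi$ (resp. $\forall\pi\in X.\varphi$) iff for some (resp. all) $t\in\Pi(X)$, $\Pi[\pi\mapsto t]\models\varphi$; $\Pi\models\exists X.\varphi$ (resp. $\forall X.\varphi$) iff for some (resp. all) $T\subseteq(2^{\mathrm{AP}})^\omega$, $\Pi[X\mapsto T]\models\varphi$. A set $T\subseteq(2^{\mathrm{AP}})^\omega$ is a model of a sentence $\varphi$ ($T\models\varphi$) if the assignment with $X_a\mapsto(2^{\mathrm{AP}})^\omega$, $X_d\mapsto T$ (undefined elsewhere) satisfies $\varphi$. A sentence is satisfiable if it has a model. Closed-world semantics ($\models_{\mathrm{cw}}$) is defined only for $X_a$-free formulas. Atomic propositions, Boolean connectives, the temporal operators $\mathbf{X}$ and $\mathbf{U}$, and the trace quantifiers $\exists\pi\in X$, $\forall\pi\in X$ are interpreted by the same clauses as in the standard semantics (with $\models_{\mathrm{cw}}$ in place of $\models$), while second-order quantifiers range only over subsets of $\Pi(X_d)$: $\Pi\models_{\mathrm{cw}}\exists X.\varphi$ (resp. $\forall X.\varphi$) iff for some (resp. all) $T\subseteq\Pi(X_d)$, $\Pi[X\mapsto T]\models_{\mathrm{cw}}\varphi$. A set $T\subseteq(2^{\mathrm{AP}})^\omega$ is a model of $\varphi$ under closed-world semantics ($T\models_{\mathrm{cw}}\varphi$)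 if the assignment with domain $\{X_d\}$ and $X_d\mapsto T$ satisfies $\varphi$ with respect to $\models_{\mathrm{cw}}$. -}

module Defs where

open import Data.Bool using (Bool; if_then_else_)
open import Data.Fin using (Fin)
open import Data.Fin.Subset using (Subset; _∈_)
open import Data.Maybe using (Maybe; just; nothing)
import Data.Maybe as Maybe
open import Data.Maybe.Relation.Unary.Any using (Any)
open import Data.Nat using (ℕ; _+_; _<_)
import Data.Nat as ℕ
open import Data.Product using (Σ; _×_; ∃-syntax; proj₁)
open import Data.Sum using (_⊎_)
open import Data.Unit using (⊤; tt)
open import Data.Empty using (⊥)
open import Function.Bundles using (Bijection)
open import Level using (Lift; 0ℓ)
open import Relation.Binary using (Setoid; DecidableEquality; _Respects_)
import Relation.Binary.Construct.On as On
open import Relation.Binary.PropositionalEquality using (_≡_; _≢_; refl; cong; _≗_; _→-setoid_)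
open import Relation.Nullary using (¬_; yes; no; does)
open import Relation.Nullary.Decidable using (map′)
open import Relation.Unary using (Pred)

-- AP is the n-element set Fin n, and 2^AP is Subset n.
Trace : ℕ → Set
Trace n = ℕ → Subset n

drop : ∀ {n} → ℕ → Trace n → Trace n
drop j t i = t (j + i)

-- Traces are identified when they agree at every position, so a set of traces
-- has to respect pointwise equality.
record TraceSet (n : ℕ) : Set₁ where
  field
    member : Pred (Trace n) 0ℓ
    resp   : member Respects _≗_

open TraceSet public

infix 4 _∈ᵗ_ _⊆ᵗ_

_∈ᵗ_ : ∀ {n} → Trace n → TraceSet n → Set
t ∈ᵗ T = member T t

allTraces : ∀ {n} → TraceSet n
allTraces = record { member = λ _ → ⊤ ; resp = λ _ _ → tt }

TVar : Set
TVar = ℕ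

data SVar : Set where
  Xa Xd : SVar
  var   : ℕ → SVar

var-injective : ∀ {i j} → var i ≡ var j → i ≡ j
var-injective refl = refl

_≟ˢ_ : DecidableEquality SVar
Xa    ≟ˢ Xa    = yes refl
Xa    ≟ˢ Xd    = no λ ()
Xa    ≟ˢ var _ = no λ ()
Xd    ≟ˢ Xa    = no λ ()
Xd    ≟ˢ Xd    = yes refl
Xd    ≟ˢ var _ = no λ ()
var _ ≟ˢ Xa    = no λ ()
var _ ≟ˢ Xd    = no λ ()
var i ≟ˢ var j = map′ (cong var) var-injective (i ℕ.≟ j)

data Body (n : ℕ) : Set where
  atom : Fin n → TVar → Body n
  ¬′_  : Body n → Body n
  _∨′_ : Body n → Body n → Body n
  ◯_   : Body n → Body n
  _U′_ : Body n → Body n → Body n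

data Formula (n : ℕ) : Set where
  ∃ˢ_∙_   : SVar → Formula n → Formula n
  ∀ˢ_∙_   : SVar → Formula n → Formula n
  ∃ᵗ_∈_∙_ : TVar → SVar → Formula n → Formula n
  ∀ᵗ_∈_∙_ : TVar → SVar → Formula n → Formula n
  body    : Body n → Formula n

OccursIn : ∀ {n} → TVar → Body n → Set
OccursIn π (atom _ π′) = π ≡ π′
OccursIn π (¬′ ψ)      = OccursIn π ψ
OccursIn π (ψ₁ ∨′ ψ₂)  = OccursIn π ψ₁ ⊎ OccursIn π ψ₂
OccursIn π (◯ ψ)       = OccursIn π ψ
OccursIn π (ψ₁ U′ ψ₂)  = OccursIn π ψ₁ ⊎ OccursIn π ψ₂

FreeT : ∀ {n} → TVar → Formula n → Set
FreeT π (∃ˢ _ ∙ φ)       = FreeT π φ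
FreeT π (∀ˢ _ ∙ φ)       = FreeT π φ
FreeT π (∃ᵗ π′ ∈ _ ∙ φ)  = π ≢ π′ × FreeT π φ
FreeT π (∀ᵗ π′ ∈ _ ∙ φ)  = π ≢ π′ × FreeT π φ
FreeT π (body ψ)         = OccursIn π ψ

FreeS : ∀ {n} → SVar → Formula n → Set
FreeS X (∃ˢ Y ∙ φ)       = X ≢ Y × FreeS X φ
FreeS X (∀ˢ Y ∙ φ)       = X ≢ Y × FreeS X φ
FreeS X (∃ᵗ _ ∈ Y ∙ φ)   = X ≡ Y ⊎ FreeS X φ
FreeS X (∀ᵗ _ ∈ Y ∙ φ)   = X ≡ Y ⊎ FreeS X φ
FreeS X (body _)         = ⊥

IsSentence : ∀ {n} → Formula n → Set
IsSentence φ = (∀ π → ¬ FreeT π φ) × (∀ X → FreeS X φ → X ≡ Xa ⊎ X ≡ Xd)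

-- Binding occurrences of Xa are excluded as well as uses of it.
XaFree : ∀ {n} → Formula n → Set
XaFree (∃ˢ X ∙ φ)       = X ≢ Xa × XaFree φ
XaFree (∀ˢ X ∙ φ)       = X ≢ Xa × XaFree φ
XaFree (∃ᵗ _ ∈ X ∙ φ)   = X ≢ Xa × XaFree φ
XaFree (∀ᵗ _ ∈ X ∙ φ)   = X ≢ Xa × XaFree φ
XaFree (body _)         = ⊤

record Assignment (n : ℕ) : Set₁ where
  constructor assignment
  field
    traces : TVar → Maybe (Trace n)
    sets   : SVar → Maybe (TraceSet n)

open Assignment public

_[_↦ᵗ_] : ∀ {n} → Assignment n → TVar → Trace n → Assignment n
traces (Π [ π ↦ᵗ t ]) π′ = if does (π ℕ.≟ π′) then just t else traces Π π′
sets   (Π [ π ↦ᵗ t ])    = sets Π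

_[_↦ˢ_] : ∀ {n} → Assignment n → SVar → TraceSet n → Assignment n
traces (Π [ X ↦ˢ T ])    = traces Π
sets   (Π [ X ↦ˢ T ]) Y = if does (X ≟ˢ Y) then just T else sets Π Y

_[_,∞⟩ : ∀ {n} → Assignment n → ℕ → Assignment n
traces (Π [ j ,∞⟩) π = Maybe.map (drop j) (traces Π π)
sets   (Π [ j ,∞⟩)   = sets Π

-- An atom over an undefined trace variable is false, and an undefined
-- second-order variable has no elements; neither case arises for sentences
-- under the assignments used below.
infix 4 _⊨ᵇ_ _⊨_ _⊨cw_ _⊨model_ _⊨cw-model_

_⊨ᵇ_ : ∀ {n} → Assignment n → Body n → Set
Π ⊨ᵇ atom p π   = Any (λ t → p ∈ t 0) (traces Π π)
Π ⊨ᵇ (¬′ ψ)     = ¬ (Π ⊨ᵇ ψ)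
Π ⊨ᵇ (ψ₁ ∨′ ψ₂) = (Π ⊨ᵇ ψ₁) ⊎ (Π ⊨ᵇ ψ₂)
Π ⊨ᵇ (◯ ψ)      = (Π [ 1 ,∞⟩) ⊨ᵇ ψ
Π ⊨ᵇ (ψ₁ U′ ψ₂) =
  ∃[ j ] ((Π [ j ,∞⟩) ⊨ᵇ ψ₂) × (∀ j′ → j′ < j → (Π [ j′ ,∞⟩) ⊨ᵇ ψ₁)

_∈⟦_⟧_ : ∀ {n} → Trace n → SVar → Assignment n → Set₁
t ∈⟦ X ⟧ Π = Any (t ∈ᵗ_) (sets Π X)

_⊨_ : ∀ {n} → Assignment n → Formula n → Set₁
Π ⊨ (∃ˢ X ∙ φ)     = ∃[ T ] (Π [ X ↦ˢ T ]) ⊨ φ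
Π ⊨ (∀ˢ X ∙ φ)     = ∀ T → (Π [ X ↦ˢ T ]) ⊨ φ
Π ⊨ (∃ᵗ π ∈ X ∙ φ) = ∃[ t ] (t ∈⟦ X ⟧ Π) × ((Π [ π ↦ᵗ t ]) ⊨ φ)
Π ⊨ (∀ᵗ π ∈ X ∙ φ) = ∀ t → t ∈⟦ X ⟧ Π → (Π [ π ↦ᵗ t ]) ⊨ φ
Π ⊨ body ψ         = Lift _ (Π ⊨ᵇ ψ)

_⊆ᵗ_ : ∀ {n} → TraceSet n → (Trace n → Set₁) → Set₁
T ⊆ᵗ P = ∀ t → t ∈ᵗ T → P t

-- Only meaningful for formulas satisfying XaFree.
_⊨cw_ : ∀ {n} → Assignment n → Formula n → Set₁
Π ⊨cw (∃ˢ X ∙ φ)     = ∃[ T ] (T ⊆ᵗ (_∈⟦ Xd ⟧ Π)) × ((Π [ X ↦ˢ T ]) ⊨cw φ)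
Π ⊨cw (∀ˢ X ∙ φ)     = ∀ T → T ⊆ᵗ (_∈⟦ Xd ⟧ Π) → (Π [ X ↦ˢ T ]) ⊨cw φ
Π ⊨cw (∃ᵗ π ∈ X ∙ φ) = ∃[ t ] (t ∈⟦ X ⟧ Π) × ((Π [ π ↦ᵗ t ]) ⊨cw φ)
Π ⊨cw (∀ᵗ π ∈ X ∙ φ) = ∀ t → t ∈⟦ X ⟧ Π → (Π [ π ↦ᵗ t ]) ⊨cw φ
Π ⊨cw body ψ         = Lift _ (Π ⊨ᵇ ψ)

∅ᴬ : ∀ {n} → Assignment n
∅ᴬ = assignment (λ _ → nothing) (λ _ → nothing)

_⊨model_ : ∀ {n} → TraceSet n → Formula n → Set₁
T ⊨model φ = ((∅ᴬ [ Xa ↦ˢ allTraces ]) [ Xd ↦ˢ T ]) ⊨ φ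

_⊨cw-model_ : ∀ {n} → TraceSet n → Formula n → Set₁
T ⊨cw-model φ = (∅ᴬ [ Xd ↦ˢ T ]) ⊨cw φ

elements : ∀ {n} → TraceSet n → Setoid 0ℓ 0ℓ
elements {n} T = On.setoid {B = Σ (Trace n) (_∈ᵗ T)} (ℕ →-setoid Subset n) proj₁

-- 𝔠 is taken as 2^ℵ₀, the cardinality of ℕ → Bool up to pointwise equality.
HasCardinality𝔠 : ∀ {n} → TraceSet n → Set
HasCardinality𝔠 T = Bijection (elements T) (ℕ →-setoid Bool)

{-# OPTIONS --safe #-}
-- Over a single proposition a trace is a subset of ℕ, and both sentences force
-- X_d to be the set of all traces.  Under standard semantics ∀X.∀π∈X ranges over
-- all traces, so it suffices to say that each of them is in X_d.  Under
-- closed-world semantics the sentence says that X_d contains ∅ and {0}, is closed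
-- under k ↦ k + 1, and is closed under unions of subsets X of X_d.  Then X_d
-- contains all singletons, and every t is the union of the members of X_d below t.
module Submission where

open import Defs
open import Axiom.ExcludedMiddle using (ExcludedMiddle)
open import Data.Bool using (true; false)
open import Data.Empty using (⊥)
open import Data.Fin using (zero)
open import Data.Fin.Subset using (Subset; _∈_)
open import Data.List using (List; []; _∷_; _++_; filter)
import Data.List.Membership.Propositional as List
open import Data.List.Membership.Propositional.Properties using (∈-++⁺ˡ; ∈-++⁺ʳ; ∈-filter⁺)
open import Data.List.Relation.Unary.Any using (here)
open import Data.Maybe as Maybe using (just)
open import Data.Maybe.Relation.Unary.Any as Any using (Any; just)
open import Data.Nat using (ℕ; zero; suc; NonZero; _≟_)
open import Data.Nat.Properties using (+-identityʳ; +-comm; suc-injective)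
open import Data.Product using (_×_; ∃-syntax; _,_; proj₁; proj₂)
open import Data.Sum using (inj₁; inj₂)
open import Data.Unit using (tt)
open import Data.Vec as Vec using (_∷_; []; head)
open import Function using (id; _∘_; case_of_)
open import Function.Bundles using (_⇔_; mk⇔; Equivalence)
open import Level using (0ℓ; Lift; lift; lower) renaming (suc to lsuc)
open import Relation.Binary.PropositionalEquality
  using (_≡_; refl; sym; cong; subst; _≗_)
open import Relation.Nullary using (¬_; Dec; yes; no; does; contradiction)
open import Relation.Nullary.Decidable using (map′; ¬?; decidable-stable; toSum)

open Equivalence using (to; from)

private variable
  n : ℕ

-- Free trace variables as computable lists.

bodyVars : Body n → List TVar
bodyVars (atom _ π) = π ∷ []
bodyVars (¬′ ψ)     = bodyVars ψ
bodyVars (ψ₁ ∨′ ψ₂) = bodyVars ψ₁ ++ bodyVars ψ₂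
bodyVars (◯ ψ)      = bodyVars ψ
bodyVars (ψ₁ U′ ψ₂) = bodyVars ψ₁ ++ bodyVars ψ₂

freeTVars : Formula n → List TVar
freeTVars (∃ˢ _ ∙ φ)     = freeTVars φ
freeTVars (∀ˢ _ ∙ φ)     = freeTVars φ
freeTVars (∃ᵗ π ∈ _ ∙ φ) = filter (λ π′ → ¬? (π′ ≟ π)) (freeTVars φ)
freeTVars (∀ᵗ π ∈ _ ∙ φ) = filter (λ π′ → ¬? (π′ ≟ π)) (freeTVars φ)
freeTVars (body ψ)       = bodyVars ψ

OccursIn⇒∈bodyVars : ∀ {π} (ψ : Body n) → OccursIn π ψ → π List.∈ bodyVars ψ
OccursIn⇒∈bodyVars (atom _ _) eq       = here eq
OccursIn⇒∈bodyVars (¬′ ψ)     o        = OccursIn⇒∈bodyVars ψ o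
OccursIn⇒∈bodyVars (ψ₁ ∨′ ψ₂) (inj₁ o) = ∈-++⁺ˡ (OccursIn⇒∈bodyVars ψ₁ o)
OccursIn⇒∈bodyVars (ψ₁ ∨′ ψ₂) (inj₂ o) = ∈-++⁺ʳ _ (OccursIn⇒∈bodyVars ψ₂ o)
OccursIn⇒∈bodyVars (◯ ψ)      o        = OccursIn⇒∈bodyVars ψ o
OccursIn⇒∈bodyVars (ψ₁ U′ ψ₂) (inj₁ o) = ∈-++⁺ˡ (OccursIn⇒∈bodyVars ψ₁ o)
OccursIn⇒∈bodyVars (ψ₁ U′ ψ₂) (inj₂ o) = ∈-++⁺ʳ _ (OccursIn⇒∈bodyVars ψ₂ o)

FreeT⇒∈freeTVars : ∀ {π} (φ : Formula n) → FreeT π φ → π List.∈ freeTVars φ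
FreeT⇒∈freeTVars (∃ˢ _ ∙ φ)     f       = FreeT⇒∈freeTVars φ f
FreeT⇒∈freeTVars (∀ˢ _ ∙ φ)     f       = FreeT⇒∈freeTVars φ f
FreeT⇒∈freeTVars (∃ᵗ _ ∈ _ ∙ φ) (≢ , f) = ∈-filter⁺ _ (FreeT⇒∈freeTVars φ f) ≢
FreeT⇒∈freeTVars (∀ᵗ _ ∈ _ ∙ φ) (≢ , f) = ∈-filter⁺ _ (FreeT⇒∈freeTVars φ f) ≢
FreeT⇒∈freeTVars (body ψ)       o       = OccursIn⇒∈bodyVars ψ o

-- Closedness of a concrete sentence becomes a list computation that `refl` settles, in place of a
-- case analysis on `FreeT`.
freeTVars-[]⇒closed : (φ : Formula n) → freeTVars φ ≡ [] → ∀ π → ¬ FreeT π φ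
freeTVars-[]⇒closed φ eq π f with subst (π List.∈_) eq (FreeT⇒∈freeTVars φ f)
... | ()

-- Traces over one proposition as subsets of ℕ.

infix 5 _∋_

_∋_ : Trace 1 → ℕ → Set
t ∋ i = zero ∈ t i

∋-ext : ∀ {s t : Trace 1} → (∀ i → s ∋ i → t ∋ i) → (∀ i → t ∋ i → s ∋ i) → s ≗ t
∋-ext {s} {t} s⊆t t⊆s i = subset-ext (s i) (t i) (s⊆t i) (t⊆s i)
  where
  subset-ext : (u v : Subset 1) → (zero ∈ u → zero ∈ v) → (zero ∈ v → zero ∈ u) → u ≡ v
  subset-ext (true  ∷ []) (true  ∷ []) _ _ = refl
  subset-ext (true  ∷ []) (false ∷ []) f _ with f Vec.here
  ... | ()
  subset-ext (false ∷ []) (true  ∷ []) _ g with g Vec.here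
  ... | ()
  subset-ext (false ∷ []) (false ∷ []) _ _ = refl

∋-resp : ∀ {s t : Trace 1} → s ≗ t → ∀ i → t ∋ i → s ∋ i
∋-resp s≗t i = subst (zero ∈_) (sym (s≗t i))

-- With one proposition `t i` is a single bit, which `head` extracts; fullness is what gives
-- surjectivity.
full⇒𝔠 : (T : TraceSet 1) → (∀ t → t ∈ᵗ T) → HasCardinality𝔠 T
full⇒𝔠 T full = record
  { to        = λ (t , _) i → head (t i)
  ; cong      = λ s≗t i → cong head (s≗t i)
  ; bijective = (λ h i → head-injective _ _ (h i))
              , λ f → ((λ i → f i ∷ []) , full _) , λ s≗ i → cong head (s≗ i)
  }
  where
  head-injective : (u v : Subset 1) → head u ≡ head v → u ≡ v
  head-injective (_ ∷ []) (_ ∷ []) refl = refl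

-- Derived connectives and their classical meaning.

infixr 6 _∧′_
infixr 5 _⇒′_

_∧′_ _⇒′_ : Body n → Body n → Body n
ψ₁ ∧′ ψ₂ = ¬′ ((¬′ ψ₁) ∨′ (¬′ ψ₂))
ψ₁ ⇒′ ψ₂ = (¬′ ψ₁) ∨′ ψ₂

-- The syntax has no constant for truth, so the left operand of `U′` is an instance of excluded
-- middle, built from `ψ` so that no new trace variable occurs.
F′ G′ : Body n → Body n
F′ ψ = (ψ ∨′ (¬′ ψ)) U′ ψ
G′ ψ = ¬′ (F′ (¬′ ψ))

p : TVar → Body 1
p = atom zero

module Connectives (em : ExcludedMiddle (lsuc 0ℓ)) where

  dec : (P : Set) → Dec P
  dec P = map′ lower lift (em {Lift (lsuc 0ℓ) P})

  -- A record because ⊨ᵇ is defined by recursion: Π and ψ could not be inferred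
  -- from the bare equivalence.
  record Meaning (Π : Assignment n) (ψ : Body n) (P : Set) : Set where
    constructor meaning
    field equiv : (Π ⊨ᵇ ψ) ⇔ P

    sound : Π ⊨ᵇ ψ → P
    sound = to equiv

    complete : P → Π ⊨ᵇ ψ
    complete = from equiv

  open Meaning public

  private variable
    Π   : Assignment n
    ψ χ : Body n
    P Q : Set
    R   : ℕ → Set

  ¬-meaning : Meaning Π ψ P → Meaning Π (¬′ ψ) (¬ P)
  ¬-meaning f = meaning (mk⇔ (λ ¬ψ → ¬ψ ∘ complete f) (λ ¬P → ¬P ∘ sound f))

  -- `∧′` is a De Morgan encoding, so a satisfied conjunction yields each conjunct only up to double
  -- negation, which `dec` removes.
  ∧-meaning : Meaning Π ψ P → Meaning Π χ Q → Meaning Π (ψ ∧′ χ) (P × Q)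
  ∧-meaning f g = meaning (mk⇔
    (λ h → sound f (decidable-stable (dec _) (h ∘ inj₁))
         , sound g (decidable-stable (dec _) (h ∘ inj₂)))
    λ where
      (x , _) (inj₁ ¬ψ) → ¬ψ (complete f x)
      (_ , y) (inj₂ ¬χ) → ¬χ (complete g y))

  ⇒-meaning : Meaning Π ψ P → Meaning Π χ Q → Meaning Π (ψ ⇒′ χ) (P → Q)
  ⇒-meaning {P = P} f g = meaning (mk⇔
    (λ where
      (inj₁ ¬ψ) x → contradiction (complete f x) ¬ψ
      (inj₂ y)  _ → sound g y)
    λ h → case dec P of λ where
      (yes x) → inj₂ (complete g (h x))
      (no ¬x) → inj₁ (¬x ∘ sound f))

  module Temporal (Π : Assignment n) where

    F-meaning : (∀ j → Meaning (Π [ j ,∞⟩) ψ (R j)) → Meaning Π (F′ ψ) (∃[ j ] R j)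
    F-meaning f = meaning (mk⇔
      (λ (j , h , _) → j , sound (f j) h)
      (λ (j , r) → j , complete (f j) r , λ _ _ → toSum (dec _)))

    G-meaning : (∀ j → Meaning (Π [ j ,∞⟩) ψ (R j)) → Meaning Π (G′ ψ) (∀ j → R j)
    G-meaning f = meaning (mk⇔
      (λ h j → decidable-stable (dec _) (λ ¬r → sound F¬ h (j , ¬r)))
      (λ r → complete F¬ (λ (j , ¬r) → ¬r (r j))))
      where F¬ = ¬-meaning (F-meaning (λ j → ¬-meaning (f j)))

  atom-meaning : (Π : Assignment 1) → ∀ {π t} → traces Π π ≡ just t →
    Meaning Π (p π) (t ∋ 0)
  atom-meaning _ eq = meaning (subst (λ m → Any (λ t → zero ∈ t 0) m ⇔ _) (sym eq)
    (mk⇔ (λ where (just x) → x) just))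

  module Atoms (Π : Assignment 1) {π : TVar} {t : Trace 1} (eq : traces Π π ≡ just t) where

    initially : Meaning Π (p π) (t ∋ 0)
    initially = atom-meaning Π eq

    now : ∀ j → Meaning (Π [ j ,∞⟩) (p π) (t ∋ j)
    now j = subst (λ i → Meaning (Π [ j ,∞⟩) (p π) (t ∋ i)) (+-identityʳ j)
      (atom-meaning (Π [ j ,∞⟩) (cong (Maybe.map (drop j)) eq))

    next : ∀ j → Meaning (Π [ j ,∞⟩) (◯ p π) (t ∋ suc j)
    -- Dropping `j` and then 1 reads position `j + 1`. The indices of `Meaning` differ from those of
    -- the atom, but both unfold to the same satisfaction type, so the equivalence is unwrapped and
    -- repacked.
    next j = subst (λ i → Meaning (Π [ j ,∞⟩) (◯ p π) (t ∋ i)) (+-comm j 1)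
      (meaning (equiv (atom-meaning ((Π [ j ,∞⟩) [ 1 ,∞⟩)
        (cong (Maybe.map (drop 1) ∘ Maybe.map (drop j)) eq))))

-- The two sentences.

everyMatrix : Body 1
everyMatrix = G′ ((p 0 ⇒′ p 1) ∧′ (p 1 ⇒′ p 0))

every : Formula 1
every = ∀ˢ var 0 ∙ ∀ᵗ 0 ∈ var 0 ∙ ∃ᵗ 1 ∈ Xd ∙ body everyMatrix

every-isSentence : IsSentence every
every-isSentence = freeTVars-[]⇒closed every refl , λ where
  X (X≢X₀ , inj₁ X≡X₀)        → contradiction X≡X₀ X≢X₀
  X (_    , inj₂ (inj₁ X≡Xd)) → inj₂ X≡Xd

every-XaFree : XaFree every
every-XaFree = (λ ()) , (λ ()) , (λ ()) , tt

-- In the scope of the quantifiers of unions below, e is ∅, z is {0}, ρ↑ is ρ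
-- shifted by one, and σ is the union of X: it contains every π ∈ X, and a ρ that
-- meets it also meets some τ ∈ X.
module Unions where

  e z σ π ρ ρ↑ τ : TVar
  e = 0
  z = 1
  σ = 2
  π = 3
  ρ = 4
  ρ↑ = 5
  τ = 6

  X : SVar
  X = var 0

  matrix : Body 1
  matrix = G′ (¬′ p e)
    ∧′ (p z ∧′ G′ (¬′ (◯ p z)))
    ∧′ ((¬′ p ρ↑) ∧′ G′ (((◯ p ρ↑) ⇒′ p ρ) ∧′ (p ρ ⇒′ (◯ p ρ↑))))
    ∧′ G′ (p π ⇒′ p σ)
    ∧′ (F′ (p ρ ∧′ p σ) ⇒′ F′ (p ρ ∧′ p τ))

  -- Formulas are prenex, so all conditions share one prefix. What follows `∀ᵗ π ∈ X` is vacuous for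
  -- empty `X`. `τ` may depend on `ρ`, whereas `σ` is fixed before `π` and `ρ`.
  unions : Formula 1
  unions = ∃ᵗ e ∈ Xd ∙ ∃ᵗ z ∈ Xd ∙ ∀ˢ X ∙ ∃ᵗ σ ∈ Xd ∙ ∀ᵗ π ∈ X ∙ ∀ᵗ ρ ∈ Xd ∙
    ∃ᵗ ρ↑ ∈ Xd ∙ ∃ᵗ τ ∈ X ∙ body matrix

  unions-isSentence : IsSentence unions
  unions-isSentence = freeTVars-[]⇒closed unions refl , λ where
    _ (inj₁ eq) → inj₂ eq
    _ (inj₂ (inj₁ eq)) → inj₂ eq
    _ (inj₂ (inj₂ (_ , inj₁ eq))) → inj₂ eq
    _ (inj₂ (inj₂ (≢ , inj₂ (inj₁ eq)))) → contradiction eq ≢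
    _ (inj₂ (inj₂ (_ , inj₂ (inj₂ (inj₁ eq))))) → inj₂ eq
    _ (inj₂ (inj₂ (_ , inj₂ (inj₂ (inj₂ (inj₁ eq)))))) → inj₂ eq
    _ (inj₂ (inj₂ (≢ , inj₂ (inj₂ (inj₂ (inj₂ (inj₁ eq))))))) → contradiction eq ≢

  unions-XaFree : XaFree unions
  unions-XaFree =
    (λ ()) , (λ ()) , (λ ()) , (λ ()) , (λ ()) , (λ ()) , (λ ()) , (λ ()) , tt

open Unions using (unions; unions-isSentence; unions-XaFree)

-- Satisfiability of both sentences, and fullness of their models.

module Models (em : ExcludedMiddle (lsuc 0ℓ)) where

  open Connectives em

  -- Excluded middle gives each predicate a characteristic function, so unions and shifts exist as
  -- traces.
  comprehension : (P : ℕ → Set) → ∃[ t ] ∀ i → t ∋ i ⇔ P i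
  comprehension P = (λ i → does (dec (P i)) ∷ []) , λ i → ∋⇔ (dec (P i))
    where
    ∋⇔ : ∀ {A} (d : Dec A) → zero ∈ does d ∷ [] ⇔ A
    ∋⇔ (yes a) = mk⇔ (λ _ → a) (λ _ → Vec.here)
    ∋⇔ (no ¬a) = mk⇔ (λ ()) (λ a → contradiction a ¬a)

  module _ (T X : TraceSet 1) (s t : Trace 1) where

    everyValuation : Assignment 1
    everyValuation =
      ((((∅ᴬ [ Xa ↦ˢ allTraces ]) [ Xd ↦ˢ T ]) [ var 0 ↦ˢ X ]) [ 0 ↦ᵗ s ]) [ 1 ↦ᵗ t ]

    everyMatrix-meaning : Meaning everyValuation everyMatrix
      (∀ i → (s ∋ i → t ∋ i) × (t ∋ i → s ∋ i))
    everyMatrix-meaning = G-meaning λ j →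
      ∧-meaning (⇒-meaning (now refl j) (now refl j)) (⇒-meaning (now refl j) (now refl j))
      where
      open Temporal everyValuation
      open Atoms everyValuation

  every-model : allTraces ⊨model every
  every-model X t _ = t , just tt , lift (complete (everyMatrix-meaning allTraces X t t)
    λ _ → id , id)

  every-full : ∀ T → T ⊨model every → ∀ t → t ∈ᵗ T
  -- Standard semantics allows `allTraces` as a value of the set variable, so `t` is arbitrary. The
  -- match found in `T` is only pointwise, which `resp T` absorbs.
  every-full T h t with h allTraces t (just tt)
  ... | s , just s∈T , lift b = resp T (∋-ext (proj₂ ∘ t≈s) (proj₁ ∘ t≈s)) s∈T
    where t≈s = sound (everyMatrix-meaning T allTraces t s) b

  module _ (e z σ π ρ ρ↑ τ : Trace 1) where

    MatrixMeaning : Set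
    MatrixMeaning = (∀ i → ¬ e ∋ i)
      × (z ∋ 0 × (∀ i → ¬ z ∋ suc i))
      × ((¬ ρ↑ ∋ 0) × (∀ i → (ρ↑ ∋ suc i → ρ ∋ i) × (ρ ∋ i → ρ↑ ∋ suc i)))
      × (∀ i → π ∋ i → σ ∋ i)
      × ((∃[ i ] ρ ∋ i × σ ∋ i) → ∃[ i ] ρ ∋ i × τ ∋ i)

    valuation : TraceSet 1 → TraceSet 1 → Assignment 1
    valuation T X =
      ((((((((∅ᴬ [ Xd ↦ˢ T ]) [ 0 ↦ᵗ e ]) [ 1 ↦ᵗ z ]) [ var 0 ↦ˢ X ]) [ 2 ↦ᵗ σ ]) [ 3 ↦ᵗ π ])
        [ 4 ↦ᵗ ρ ]) [ 5 ↦ᵗ ρ↑ ]) [ 6 ↦ᵗ τ ]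

    matrix-meaning : ∀ T X → Meaning (valuation T X) Unions.matrix MatrixMeaning
    matrix-meaning T X =
      ∧-meaning (G-meaning λ j → ¬-meaning (now refl j)) (
      ∧-meaning (∧-meaning (initially refl) (G-meaning λ j → ¬-meaning (next refl j))) (
      ∧-meaning (∧-meaning (¬-meaning (initially refl)) (G-meaning λ j →
        ∧-meaning (⇒-meaning (next refl j) (now refl j))
                  (⇒-meaning (now refl j) (next refl j)))) (
      ∧-meaning (G-meaning λ j → ⇒-meaning (now refl j) (now refl j))
        (⇒-meaning (F-meaning λ j → ∧-meaning (now refl j) (now refl j))
                   (F-meaning λ j → ∧-meaning (now refl j) (now refl j))))))
      where
      open Temporal (valuation T X)
      open Atoms (valuation T X)

  unions-model : allTraces ⊨cw-model unions
  unions-model =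
    e , just tt , z , just tt , λ X _ →
    let σ , σ⇔ = comprehension λ i → ∃[ s ] s ∈ᵗ X × s ∋ i in
    σ , just tt , λ where
      π (just π∈X) ρ _ →
        let ρ↑ , ρ↑⇔ = comprehension λ i → ∃[ j ] i ≡ suc j × ρ ∋ j
            τ , τ∈X , ρ∩τ = meeting X π ρ σ π∈X (to ∘ σ⇔)
        in ρ↑ , just tt , τ , just τ∈X
          , lift (complete (matrix-meaning e z σ π ρ ρ↑ τ allTraces X)
          ( (λ i → to (e⇔ i))
          , (from (z⇔ 0) refl , λ i z∋ → case to (z⇔ (suc i)) z∋ of λ ())
          , ( (λ h → case to (ρ↑⇔ 0) h of λ ())
            , λ i → (λ h → case to (ρ↑⇔ (suc i)) h of λ where (_ , refl , ρ∋) → ρ∋)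
                  , λ ρ∋ → from (ρ↑⇔ (suc i)) (i , refl , ρ∋))
          , (λ i π∋ → from (σ⇔ i) (π , π∈X , π∋))
          , ρ∩τ))
    where
    e = proj₁ (comprehension λ _ → ⊥)
    e⇔ = proj₂ (comprehension λ _ → ⊥)
    z = proj₁ (comprehension (_≡ 0))
    z⇔ = proj₂ (comprehension (_≡ 0))

    meeting : ∀ X π ρ σ → π ∈ᵗ X → (∀ i → σ ∋ i → ∃[ s ] s ∈ᵗ X × s ∋ i) →
      ∃[ τ ] τ ∈ᵗ X × ((∃[ i ] ρ ∋ i × σ ∋ i) → ∃[ i ] ρ ∋ i × τ ∋ i)
    meeting X π ρ σ π∈X σ⊆⋃X with dec (∃[ i ] ρ ∋ i × σ ∋ i)
    -- `τ` must lie in `X` even when there is nothing to meet; the given `π` serves as default.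
    ... | no ¬ρ∩σ = π , π∈X , λ ρ∩σ → contradiction ρ∩σ ¬ρ∩σ
    ... | yes (i , ρ∋ , σ∋) with σ⊆⋃X i σ∋
    ...   | τ , τ∈X , τ∋ = τ , τ∈X , λ _ → i , ρ∋ , τ∋

  -- Closed-world models contain every trace.

  module _ (T : TraceSet 1) (T⊨ : T ⊨cw-model unions) where

    private
      e = proj₁ T⊨
      z = proj₁ (proj₂ (proj₂ T⊨))
      closed = proj₂ (proj₂ (proj₂ (proj₂ T⊨)))

      e∈T : e ∈ᵗ T
      e∈T = Any.drop-just (proj₁ (proj₂ T⊨))

      z∈T : z ∈ᵗ T
      z∈T = Any.drop-just (proj₁ (proj₂ (proj₂ (proj₂ T⊨))))

    -- `e` and `z` are quantified before `X`, so all instances obtained here speak of the same two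
    -- traces.
    union : ∀ X → X ⊆ᵗ (λ s → Any (s ∈ᵗ_) (just T)) →
      ∃[ σ ] σ ∈ᵗ T × (∀ π ρ → π ∈ᵗ X → ρ ∈ᵗ T →
        ∃[ ρ↑ ] ρ↑ ∈ᵗ T × ∃[ τ ] τ ∈ᵗ X × MatrixMeaning e z σ π ρ ρ↑ τ)
    union X X⊆T with closed X X⊆T
    ... | σ , just σ∈T , h = σ , σ∈T , λ π ρ π∈X ρ∈T →
      case h π (just π∈X) ρ (just ρ∈T) of λ where
        (ρ↑ , just ρ↑∈T , τ , just τ∈X , lift b) →
          ρ↑ , ρ↑∈T , τ , τ∈X , sound (matrix-meaning e z σ π ρ ρ↑ τ T X) b

    -- Taking `X` to be all of `T` makes `e` a permitted value of `π`. The conditions on `e` and `z`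
    -- are reached only through an instance of the matrix, so they are returned as well.
    shift : ∀ ρ → ρ ∈ᵗ T → ∃[ ρ↑ ] ρ↑ ∈ᵗ T × z ∋ 0 × (∀ i → ¬ e ∋ i) × (∀ i → ¬ z ∋ suc i)
      × ¬ ρ↑ ∋ 0 × (∀ i → (ρ↑ ∋ suc i → ρ ∋ i) × (ρ ∋ i → ρ↑ ∋ suc i))
    shift ρ ρ∈T with union T (λ _ → just)
    ... | _ , _ , h with h e ρ e∈T ρ∈T
    ... | ρ↑ , ρ↑∈T , _ , _ , e≡∅ , (z0 , z≤0) , (¬0 , ↑) , _ =
      ρ↑ , ρ↑∈T , z0 , e≡∅ , z≤0 , ¬0 , ↑

    singleton∈ : ∀ n → ∃[ s ] s ∈ᵗ T × (∀ i → s ∋ i ⇔ i ≡ n)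
    -- `shift` is called here for the facts that make `z` the singleton of 0.
    singleton∈ zero with shift z z∈T
    ... | _ , _ , z0 , _ , z≤0 , _ = z , z∈T , λ where
      zero    → mk⇔ (λ _ → refl) (λ _ → z0)
      (suc i) → mk⇔ (λ z∋ → contradiction z∋ (z≤0 i)) (λ ())
    singleton∈ (suc n) with singleton∈ n
    ... | s , s∈T , s⇔ with shift s s∈T
    ... | s↑ , s↑∈T , _ , _ , _ , ¬0 , ↑ = s↑ , s↑∈T , λ where
      zero    → mk⇔ (λ s↑∋ → contradiction s↑∋ ¬0) (λ ())
      (suc i) → mk⇔ (cong suc ∘ to (s⇔ i) ∘ proj₁ (↑ i))
                    (proj₂ (↑ i) ∘ from (s⇔ i) ∘ suc-injective)

    -- Besides the singletons inside `t` this family contains `e`, so it is nonempty even for empty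
    -- `t` and the matrix can always be instantiated.
    below : Trace 1 → TraceSet 1
    below t = record
      { member = λ s → s ∈ᵗ T × (∀ i → s ∋ i → t ∋ i)
      ; resp   = λ s≗s′ (s∈T , s⊆t) →
          resp T s≗s′ s∈T , λ i → s⊆t i ∘ ∋-resp s≗s′ i
      }

    unions-full : ∀ t → t ∈ᵗ T
    unions-full t with union (below t) (λ _ → just ∘ proj₁)
    ... | σ , σ∈T , h = resp T (∋-ext σ⊆t t⊆σ) σ∈T
      where
      e∈below : e ∈ᵗ below t
      e∈below = let _ , _ , _ , e≡∅ , _ = shift e e∈T in
        e∈T , λ i e∋ → contradiction e∋ (e≡∅ i)

      t⊆σ : ∀ i → t ∋ i → σ ∋ i
      -- The singleton of `i` belongs to `below t`, so as a value of `π` it is contained in `σ`.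
      t⊆σ i t∋ with singleton∈ i
      ... | s , s∈T , s⇔
          with h s s (s∈T , λ j s∋ → subst (t ∋_) (sym (to (s⇔ j) s∋)) t∋) s∈T
      ... | _ , _ , _ , _ , _ , _ , _ , π⊆σ , _ = π⊆σ i (from (s⇔ i) refl)

      σ⊆t : ∀ i → σ ∋ i → t ∋ i
      -- With `ρ` the singleton of `i`, meeting `σ` forces `ρ` to meet some `τ` contained in `t`,
      -- necessarily at `i`; `e` serves as `π`.
      σ⊆t i σ∋ with singleton∈ i
      ... | s , s∈T , s⇔ with h e s e∈below s∈T
      ... | _ , _ , τ , (_ , τ⊆t) , _ , _ , _ , _ , s∩τ with s∩τ (i , from (s⇔ i) refl , σ∋)
      ... | j , s∋ , τ∋ = subst (t ∋_) (to (s⇔ j) s∋) (τ⊆t j τ∋)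

theorem3p4 : ExcludedMiddle (lsuc 0ℓ) →
    (∃[ n ] NonZero n × (∃[ φ ] IsSentence {n} φ × XaFree φ
    × (∃[ T ] T ⊨model φ)
    × (∀ T → T ⊨model φ → HasCardinality𝔠 T)))
    ×
    (∃[ n ] NonZero n × (∃[ φ ] IsSentence {n} φ × XaFree φ
    × (∃[ T ] T ⊨cw-model φ)
    × (∀ T → T ⊨cw-model φ → HasCardinality𝔠 T)))
theorem3p4 em =
    (1 , _ , every , every-isSentence , every-XaFree
      , (allTraces , every-model) , λ T → full⇒𝔠 T ∘ every-full T)
  , (1 , _ , unions , unions-isSentence , unions-XaFree
      , (allTraces , unions-model) , λ T → full⇒𝔠 T ∘ unions-full T)
  where open Models em
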